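{- Let $g\ge0$ be an integer. Every primitive partition of genus $g$ is a partition of a set $\{1,\ldots,n\}$ with at most $6(2g-1)$ elements. Moreover, for any $g$ there is a finite number of semiprimitive partitions of genus $g$, hence also a finite number of primitive ones.
   Context: For $n\ge1$ let $\zeta_n=(1,2,\ldots,n)$; additions $i+1$ are modulo $n$, i.e. $i+1$ means $\zeta_n(i)$. Let $z(\cdot)$ be the number of cycles of a permutation (fixed points included); products are composed right to left. The genus $g(\alpha)$ of a permutation $\alpha$ of $\{1,\ldots,n\}$, $n\ge 1$, is the nonnegative integer defined by $n+1-2g(\alpha)=z(\alpha)+z(\alpha^{ -1}\zeta_n)$. A permutation $\alpha$ of $\{1,\ldots,n\}$ is a partition if each of its cycles, listed beginning with its least element, is an increasing list. A permutation $\alpha$ is reduced if neither $\alpha$ nor $\alpha^{ -1}\zeta_n$ has a fixed point (i.e. there is no $i$ with $\alpha(i)=i$ or $\alpha(i)=i+1$). For a reduced permutation $\alpha$ and a pair $\{i,j\}\subseteq\{1,\ldots,n\}$ with $\alpha(i)=j+1$ and $\alpha(j)=i+1$, the directed edges $i\to\alpha(i)$ and $j\to\alpha(j)$ are called parallel edges. A reduced partition $\alpha$ is semiprimitive if it has no pair of parallel edges $\{i\to\alpha(i),\,j\to\alpha(j)\}$ such that $(i,\alpha(i))$ is a $2$-cycle of $\alpha$; it is primitive if it has no pair of parallel edges at all. -}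

module Defs where

open import Data.Fin.Base
  using (Fin; zero; suc; toℕ; fromℕ; fromℕ<; punchOut; _≤_; _<_)
open import Data.Fin.Permutation
  using (Permutation′; _⟨$⟩ʳ_; _⟨$⟩ˡ_; _≈_; _∘ₚ_; flip; insert; id; inverseˡ)
open import Data.Fin.Properties
  using (_≟_; _≤?_; all?; any?; pigeonhole; toℕ-fromℕ; toℕ-fromℕ<; toℕ<n)
open import Data.Integer.Base using (+_; _-_)
open import Data.List.Base using (filter; length; allFin; iterate)
open import Data.List.Relation.Unary.Linked using (Linked)
open import Data.Nat.Base as ℕ using (ℕ; zero; suc; _+_; _*_; _∸_; _/_; _%_)
open import Data.Nat.DivMod using (m≡m%n+[m/n]*n; m%n<n; n%n≡0; m<n⇒m%n≡m)
open import Data.Nat.GeneralisedArithmetic using (fold; fold-+)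
import Data.Nat.Properties as ℕ
open import Data.Product.Base using (∃-syntax; _×_; _,_)
open import Function.Base using (_∘_)
open import Function.Bundles using (Inverse)
open import Level using (0ℓ)
open import Relation.Binary.Bundles using (Setoid)
open import Relation.Binary.PropositionalEquality
  using (_≡_; _≢_; refl; sym; trans; cong; subst; setoid; module ≡-Reasoning)
open import Relation.Nullary using (¬_; Dec; yes; no; contradiction)
open import Relation.Nullary.Decidable using (map′; _→-dec_)

private variable
  m : ℕ

-- The underlying set {1, …, n}, n ≥ 1, is Fin (suc m) with n = suc m; its
-- elements are numbered from 0, which preserves their order.
Perm : ℕ → Set
Perm m = Permutation′ (suc m)

-- The last element goes to the first; the others map to the remaining ones
-- in increasing order.
ζ : Perm m
ζ {m} = insert (fromℕ m) zero id

toℕ-ζ : (i : Fin (suc m)) → toℕ (ζ ⟨$⟩ʳ i) ≡ suc (toℕ i) % suc m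
toℕ-ζ {m} i with fromℕ m ≟ i
... | yes refl = sym (trans (cong (λ k → suc k % suc m) (toℕ-fromℕ m)) (n%n≡0 (suc m)))
... | no  last≢i = trans (cong suc (toℕ-punchOut m i last≢i))
                         (sym (m<n⇒m%n≡m (ℕ.s<s (subst (ℕ._< m) (toℕ-punchOut m i last≢i) (toℕ<n _)))))
  where
  toℕ-punchOut : ∀ m (i : Fin (suc m)) (ne : fromℕ m ≢ i) → toℕ (punchOut ne) ≡ toℕ i
  toℕ-punchOut zero    zero    ne = contradiction refl ne
  toℕ-punchOut (suc m) zero    ne = refl
  toℕ-punchOut (suc m) (suc i) ne = cong suc (toℕ-punchOut m i (ne ∘ cong suc))

infixr 8 _^_·_

-- α ^ k · i is αᵏ(i).
_^_·_ : Perm m → ℕ → Fin (suc m) → Fin (suc m)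
α ^ k · i = fold i (α ⟨$⟩ʳ_) k

SameCycle : Perm m → Fin (suc m) → Fin (suc m) → Set
SameCycle α i j = ∃[ k ] α ^ k · i ≡ j

module _ (α : Perm m) where

  α-injective : ∀ {i j} → α ⟨$⟩ʳ i ≡ α ⟨$⟩ʳ j → i ≡ j
  α-injective e = trans (sym (inverseˡ α)) (trans (cong (α ⟨$⟩ˡ_) e) (inverseˡ α))

  ^-injective : ∀ k {i j} → α ^ k · i ≡ α ^ k · j → i ≡ j
  ^-injective zero    e = e
  ^-injective (suc k) e = ^-injective k (α-injective e)

  ^-+ : ∀ k l i → α ^ (k + l) · i ≡ α ^ k · α ^ l · i
  ^-+ k l i = fold-+ i (α ⟨$⟩ʳ_) k

  period : ∀ i → ∃[ p ] p ℕ.≤ m × α ^ suc p · i ≡ i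
  period i with pigeonhole (ℕ.n<1+n (suc m)) (λ k → α ^ toℕ k · i)
  ... | a , b , a<b , e = p , p≤m , ^-injective (toℕ a) (begin
      α ^ toℕ a · α ^ suc p · i  ≡⟨ ^-+ (toℕ a) (suc p) i ⟨
      α ^ (toℕ a + suc p) · i    ≡⟨ cong (α ^_· i) a+sp≡b ⟩
      α ^ toℕ b · i              ≡⟨ e ⟨
      α ^ toℕ a · i              ∎)
    where
    open ≡-Reasoning
    p : ℕ
    p = toℕ b ∸ suc (toℕ a)
    a+sp≡b : toℕ a + suc p ≡ toℕ b
    a+sp≡b = trans (ℕ.+-suc (toℕ a) p) (ℕ.m+[n∸m]≡n a<b)
    p≤m : p ℕ.≤ m
    p≤m = ℕ.s≤s⁻¹ (ℕ.≤-trans (ℕ.m≤n+m (suc p) (toℕ a))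
            (subst (ℕ._≤ suc m) (sym a+sp≡b) (ℕ.s≤s⁻¹ (toℕ<n b))))

  ^-multiple : ∀ p i → α ^ p · i ≡ i → ∀ q → α ^ (q * p) · i ≡ i
  ^-multiple p i e zero    = refl
  ^-multiple p i e (suc q) =
    trans (^-+ p (q * p) i) (trans (cong (α ^ p ·_) (^-multiple p i e q)) e)

  bounded : ∀ {i j} → SameCycle α i j → ∃[ k ] α ^ toℕ {suc m} k · i ≡ j
  bounded {i} {j} (k , e) with period i
  ... | p , p≤m , eₚ = fromℕ< r<n , (begin
      α ^ toℕ (fromℕ< r<n) · i  ≡⟨ cong (α ^_· i) (toℕ-fromℕ< r<n) ⟩
      α ^ r · i                 ≡⟨ cong (α ^ r ·_) (^-multiple (suc p) i eₚ (k / suc p)) ⟨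
      α ^ r · α ^ (k / suc p * suc p) · i  ≡⟨ ^-+ r _ i ⟨
      α ^ (r + k / suc p * suc p) · i      ≡⟨ cong (α ^_· i) (m≡m%n+[m/n]*n k (suc p)) ⟨
      α ^ k · i                 ≡⟨ e ⟩
      j                         ∎)
    where
    open ≡-Reasoning
    r = k % suc p
    r<n : r ℕ.< suc m
    r<n = ℕ.<-≤-trans (m%n<n k (suc p)) (ℕ.s≤s p≤m)

  sameCycle? : ∀ i j → Dec (SameCycle α i j)
  sameCycle? i j =
    map′ (λ (k , e) → toℕ k , e) bounded (any? λ k → α ^ toℕ k · i ≟ j)

  IsCycleMin : Fin (suc m) → Set
  IsCycleMin i = ∀ j → SameCycle α i j → i ≤ j

  isCycleMin? : ∀ i → Dec (IsCycleMin i)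
  isCycleMin? i = all? λ j → sameCycle? i j →-dec (i ≤? j)

  -- The number of cycles, each of them counted by its least element.
  z : ℕ
  z = length (filter isCycleMin? (allFin (suc m)))

  IsCycleLength : Fin (suc m) → ℕ → Set
  IsCycleLength i ℓ =
    0 ℕ.< ℓ × α ^ ℓ · i ≡ i × (∀ k → 0 ℕ.< k → α ^ k · i ≡ i → ℓ ℕ.≤ k)

  -- iterate f i ℓ lists i, f(i), f(f(i)), … up to length ℓ: a whole cycle here.
  IsPartition : Set
  IsPartition = ∀ i ℓ → IsCycleMin i → IsCycleLength i ℓ →
                Linked _<_ (iterate (α ⟨$⟩ʳ_) i ℓ)

  -- _∘ₚ_ composes from left to right, so this is i ↦ α⁻¹(ζ(i)).
  α⁻¹ζ : Perm m
  α⁻¹ζ = ζ ∘ₚ flip α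

  IsReduced : Set
  IsReduced = (∀ i → α ⟨$⟩ʳ i ≢ i) × (∀ i → α⁻¹ζ ⟨$⟩ʳ i ≢ i)

  Parallel : Fin (suc m) → Fin (suc m) → Set
  Parallel i j = i ≢ j × α ⟨$⟩ʳ i ≡ ζ ⟨$⟩ʳ j × α ⟨$⟩ʳ j ≡ ζ ⟨$⟩ʳ i

  -- (i, α(i)) is a 2-cycle of α.
  In2Cycle : Fin (suc m) → Set
  In2Cycle i = α ⟨$⟩ʳ i ≢ i × α ⟨$⟩ʳ (α ⟨$⟩ʳ i) ≡ i

HasGenus : Perm m → ℕ → Set
HasGenus {m} α g = + (suc m + 1) - + (2 * g) ≡ + (z α + z (α⁻¹ζ α))

-- Both orders of each pair of parallel edges are covered, as i and j range
-- over ordered pairs.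
IsSemiprimitivePartition : Perm m → Set
IsSemiprimitivePartition α =
  IsPartition α × IsReduced α × (∀ i j → Parallel α i j → ¬ In2Cycle α i)

IsPrimitivePartition : Perm m → Set
IsPrimitivePartition α =
  IsPartition α × IsReduced α × (∀ i j → ¬ Parallel α i j)

-- Permutations, of sets {1, …, n} with n ≥ 1 arbitrary, that satisfy P. Two of
-- them are equal when they have the same n and agree as functions; neither the
-- stored inverse functions nor the proofs of P matter.
module _ (P : ∀ {m} → Perm m → Set) where

  record PermWith : Set where
    constructor permWith
    field
      {n-1}     : ℕ
      perm      : Perm n-1
      satisfies : P perm

  data _≋_ : PermWith → PermWith → Set where
    same : ∀ {m} {α β : Perm m} {p : P α} {q : P β} →
           α ≈ β → permWith α p ≋ permWith β q

  PermWithSetoid : Setoid 0ℓ 0ℓ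
  PermWithSetoid = record
    { Carrier       = PermWith
    ; _≈_           = _≋_
    ; isEquivalence = record
      { refl  = same λ _ → refl
      ; sym   = λ { (same e) → same λ i → sym (e i) }
      ; trans = λ { (same e) (same f) → same λ i → trans (e i) (f i) }
      }
    }

  FinitelyMany : Set
  FinitelyMany = ∃[ k ] Inverse (setoid (Fin k)) PermWithSetoid

{-# OPTIONS --safe #-}

-- In a reduced permutation α of n points, the cycles of α and of β = α⁻¹ζ have
-- length at least 2.  If T is the number of points on 2-cycles of a permutation
-- without fixed points, it has at most T/2 + (n − T)/3 cycles, that is, 6z ≤ 2n + T.
-- A pair of parallel edges is a 2-cycle of β, so when α is semiprimitive no point
-- lies both on a 2-cycle of α and on one of β, whence 6(z(α) + z(β)) ≤ 5n and the
-- genus formula gives n + 6 ≤ 12g.  Since primitive permutations are semiprimitive,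
-- both finiteness claims reduce to filtering the permutations of bounded size.
module Submission where

open import Defs
import Algebra.Properties.CommutativeMonoid.Sum
import Data.Fin.Base as Fin
open import Data.Fin.Base using (Fin; zero; suc)
open import Data.Fin.Permutation
  using (Permutation′; _⟨$⟩ʳ_; _⟨$⟩ˡ_; _≈_; insert; remove; insert-remove; id; inverseʳ)
open import Data.Fin.Properties using (_≟_; _<?_; all?; ≤-antisym)
open import Data.Integer.Base using (+_; _-_; _*_; _≤_; +≤+)
import Data.Integer.Base as ℤ
import Data.Integer.Properties as ℤ
import Data.Integer.Tactic.RingSolver as ℤ-Solver
open import Data.List.Base
  using (List; []; _∷_; allFin; cartesianProductWith; concatMap; deduplicate;
         filter; iterate; length; lookup; tabulate; upTo)
open import Data.List.Membership.Propositional using (lose)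
open import Data.List.Membership.Propositional.Properties using (∈-allFin; ∈-lookup; ∈-upTo⁺)
open import Data.List.Properties using (filter-≐)
import Data.List.Relation.Unary.All as All
open import Data.List.Relation.Unary.AllPairs.Core using (_∷_)
open import Data.List.Relation.Unary.Any as Any using (Any; here)
import Data.List.Relation.Unary.Any.Properties as Any
open import Data.List.Relation.Unary.Enumerates.Setoid using (IsEnumeration)
open import Data.List.Relation.Unary.Enumerates.Setoid.Properties
  using (deduplicate⁺; lookup-surjective)
open import Data.List.Relation.Unary.Linked using (Linked; linked?)
open import Data.List.Relation.Unary.Unique.DecSetoid.Properties using (deduplicate-!)
open import Data.List.Relation.Unary.Unique.Setoid using (Unique)
import Data.Nat.Base as ℕ
open import Data.Nat.Base using (ℕ; suc; zero; z≤n; s≤s; z<s)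
import Data.Nat.Properties as ℕ
open import Data.Nat.Tactic.RingSolver using (solve-∀)
open import Data.Product.Base using (∃-syntax; _×_; _,_; proj₂)
open import Data.Vec.Functional using (Vector)
open import Function.Base using (_∘_)
open import Function.Bundles using (Inverse)
open import Function.Properties.Bijection using (Bijection⇒Inverse)
open import Level using (Level; 0ℓ)
open import Relation.Binary.Bundles using (Setoid; DecSetoid)
open import Relation.Binary.PropositionalEquality
  using (_≡_; _≢_; _≗_; refl; sym; trans; cong; cong₂; subst; setoid; module ≡-Reasoning)
open import Relation.Nullary using (¬_; Dec; yes; no; contradiction)
open import Relation.Nullary.Decidable using (map′; ¬?; _×-dec_; _→-dec_)
open import Relation.Unary using (Pred; Decidable)

module Σ = Algebra.Properties.CommutativeMonoid.Sum ℕ.+-0-commutativeMonoid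
open Σ using (sum)

private variable
  a : Level
  A B C : Set a
  m n : ℕ

-- Indicators of decidable properties and finite sums.

𝟙 : Dec A → ℕ
𝟙 (yes _) = 1
𝟙 (no  _) = 0

𝟙-≤1 : (A? : Dec A) → 𝟙 A? ℕ.≤ 1
𝟙-≤1 (yes _) = s≤s z≤n
𝟙-≤1 (no  _) = z≤n

𝟙-no : (A? : Dec A) → ¬ A → 𝟙 A? ≡ 0
𝟙-no (yes a) ¬a = contradiction a ¬a
𝟙-no (no _)  ¬a = refl

𝟙-exclusive : (A? : Dec A) (B? : Dec B) → ¬ (A × B) → 𝟙 A? ℕ.+ 𝟙 B? ℕ.≤ 1
𝟙-exclusive (yes a) (yes b) ¬ab = contradiction (a , b) ¬ab
𝟙-exclusive (yes _) (no _)  _   = s≤s z≤n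
𝟙-exclusive (no _)  B?      _   = 𝟙-≤1 B?

𝟙-exclusive₃ : (A? : Dec A) (B? : Dec B) (C? : Dec C) →
               ¬ (A × B) → ¬ (A × C) → ¬ (B × C) → 𝟙 A? ℕ.+ 𝟙 B? ℕ.+ 𝟙 C? ℕ.≤ 1
𝟙-exclusive₃ (yes a) (yes b) C?      ¬ab _   _   = contradiction (a , b) ¬ab
𝟙-exclusive₃ (yes a) (no _)  (yes c) _   ¬ac _   = contradiction (a , c) ¬ac
𝟙-exclusive₃ (yes _) (no _)  (no _)  _   _   _   = s≤s z≤n
𝟙-exclusive₃ (no _)  B?      C?      _   _   ¬bc = 𝟙-exclusive B? C? ¬bc

𝟙-split : (A? : Dec A) (B? : Dec B) → 𝟙 A? ≡ 𝟙 (A? ×-dec B?) ℕ.+ 𝟙 (A? ×-dec ¬? B?)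
𝟙-split (yes _) (yes _) = refl
𝟙-split (yes _) (no _)  = refl
𝟙-split (no _)  (yes _) = refl
𝟙-split (no _)  (no _)  = refl

length-filter-tabulate : {P : Pred A a} (P? : Decidable P) (f : Fin n → A) →
                         length (filter P? (tabulate f)) ≡ sum (λ i → 𝟙 (P? (f i)))
length-filter-tabulate {n = zero}  P? f = refl
length-filter-tabulate {n = suc n} P? f with P? (f zero)
... | yes _ = cong suc (length-filter-tabulate P? (f ∘ suc))
... | no  _ = length-filter-tabulate P? (f ∘ suc)

sum-mono : {f g : Vector ℕ n} → (∀ i → f i ℕ.≤ g i) → sum f ℕ.≤ sum g
sum-mono {zero}  f≤g = z≤n
sum-mono {suc n} f≤g = ℕ.+-mono-≤ (f≤g zero) (sum-mono (f≤g ∘ suc))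

sum-≤1 : {f : Vector ℕ n} → (∀ i → f i ℕ.≤ 1) → sum f ℕ.≤ n
sum-≤1 {zero}  f≤1 = z≤n
sum-≤1 {suc n} f≤1 = ℕ.+-mono-≤ (f≤1 zero) (sum-≤1 (f≤1 ∘ suc))

-- Reindexing along `π` leaves `sum f` unchanged. The second copy of the sum may therefore be read
-- at `π i`, so that point `i` sees the values at two consecutive points of its orbit.
sum-shift₂ : (f : Vector ℕ n) (π : Permutation′ n) →
             sum f ℕ.+ sum f ≡ sum (λ i → f i ℕ.+ f (π ⟨$⟩ʳ i))
sum-shift₂ f π = trans (cong (sum f ℕ.+_) (Σ.sum-permute f π))
                       (sym (Σ.∑-distrib-+ f (f ∘ (π ⟨$⟩ʳ_))))

sum-shift₃ : (f : Vector ℕ n) (π : Permutation′ n) →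
             sum f ℕ.+ sum f ℕ.+ sum f ≡
             sum (λ i → f i ℕ.+ f (π ⟨$⟩ʳ i) ℕ.+ f (π ⟨$⟩ʳ (π ⟨$⟩ʳ i)))
sum-shift₃ f π = trans
  (cong₂ ℕ._+_ (sum-shift₂ f π)
               (trans (Σ.sum-permute f π) (Σ.sum-permute (f ∘ (π ⟨$⟩ʳ_)) π)))
  (sym (Σ.∑-distrib-+ (λ i → f i ℕ.+ f (π ⟨$⟩ʳ i)) (λ i → f (π ⟨$⟩ʳ (π ⟨$⟩ʳ i)))))

sum-disjoint : (f g : Vector ℕ n) → (∀ i → f i ℕ.+ g i ℕ.≤ 1) → sum f ℕ.+ sum g ℕ.≤ n
sum-disjoint f g f+g≤1 = ℕ.≤-trans (ℕ.≤-reflexive (sym (Σ.∑-distrib-+ f g))) (sum-≤1 f+g≤1)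

-- Intended for `p` and `q` marking one point on each 2-cycle and on each longer cycle, and `s` and
-- `t` marking all points of the two kinds. Summing the hypotheses gives 2P ≤ S, 3Q ≤ T and S + T ≤
-- n; the factor 6 clears both denominators.
weighted-sum-bound : (π : Permutation′ n) (p q s t : Vector ℕ n) →
  (∀ i → p i ℕ.+ p (π ⟨$⟩ʳ i) ℕ.≤ s i) →
  (∀ i → q i ℕ.+ q (π ⟨$⟩ʳ i) ℕ.+ q (π ⟨$⟩ʳ (π ⟨$⟩ʳ i)) ℕ.≤ t i) →
  (∀ i → s i ℕ.+ t i ℕ.≤ 1) →
  6 ℕ.* (sum p ℕ.+ sum q) ℕ.≤ 2 ℕ.* n ℕ.+ sum s
weighted-sum-bound {n} π p q s t p≤s q≤t s+t≤1 = begin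
  6 ℕ.* (P ℕ.+ Q)                            ≡⟨ regroup P Q ⟩
  3 ℕ.* (P ℕ.+ P) ℕ.+ 2 ℕ.* (Q ℕ.+ Q ℕ.+ Q)
    ≤⟨ ℕ.+-mono-≤ (ℕ.*-monoʳ-≤ 3 2P≤S) (ℕ.*-monoʳ-≤ 2 3Q≤T) ⟩
  3 ℕ.* S ℕ.+ 2 ℕ.* T                        ≡⟨ regroup′ S T ⟩
  2 ℕ.* (S ℕ.+ T) ℕ.+ S
    ≤⟨ ℕ.+-monoˡ-≤ S (ℕ.*-monoʳ-≤ 2 (sum-disjoint s t s+t≤1)) ⟩
  2 ℕ.* n ℕ.+ S                              ∎
  where
  open ℕ.≤-Reasoning
  P = sum p
  Q = sum q
  S = sum s
  T = sum t
  regroup : ∀ P Q → 6 ℕ.* (P ℕ.+ Q) ≡ 3 ℕ.* (P ℕ.+ P) ℕ.+ 2 ℕ.* (Q ℕ.+ Q ℕ.+ Q)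
  regroup = solve-∀
  regroup′ : ∀ S T → 3 ℕ.* S ℕ.+ 2 ℕ.* T ≡ 2 ℕ.* (S ℕ.+ T) ℕ.+ S
  regroup′ = solve-∀
  2P≤S : P ℕ.+ P ℕ.≤ S
  2P≤S = ℕ.≤-trans (ℕ.≤-reflexive (sum-shift₂ p π)) (sum-mono p≤s)
  3Q≤T : Q ℕ.+ Q ℕ.+ Q ℕ.≤ T
  3Q≤T = ℕ.≤-trans (ℕ.≤-reflexive (sum-shift₃ q π)) (sum-mono q≤t)

length-filter-split : {P Q : Pred (Fin n) 0ℓ} (P? : Decidable P) (Q? : Decidable Q) →
  length (filter P? (allFin n)) ≡
  sum (λ i → 𝟙 (P? i ×-dec Q? i)) ℕ.+ sum (λ i → 𝟙 (P? i ×-dec ¬? (Q? i)))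
length-filter-split P? Q? =
  trans (length-filter-tabulate P? (λ i → i))
  (trans (Σ.sum-cong-≗ (λ i → 𝟙-split (P? i) (Q? i)))
         (Σ.∑-distrib-+ (λ i → 𝟙 (P? i ×-dec Q? i)) (λ i → 𝟙 (P? i ×-dec ¬? (Q? i)))))

-- Counting cycles

module _ (α : Perm m) where

  -- This holds at fixed points as well as on 2-cycles, so it singles out the points of 2-cycles
  -- once `α` has no fixed point.
  Involuted : Fin (suc m) → Set
  Involuted i = α ⟨$⟩ʳ (α ⟨$⟩ʳ i) ≡ i

  involuted? : Decidable Involuted
  involuted? i = α ⟨$⟩ʳ (α ⟨$⟩ʳ i) ≟ i

  #involuted : ℕ
  #involuted = sum (λ i → 𝟙 (involuted? i))

  sameCycle-sym : ∀ {i j} → SameCycle α i j → SameCycle α j i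
  -- The period of `i` is given as `suc p`. After `k` steps, `k * p` further ones make `k * suc p`
  -- in total, a multiple of the period, which leads back to `i`.
  sameCycle-sym {i} (k , refl) with p , _ , e ← period α i = k ℕ.* p , (begin
    α ^ (k ℕ.* p) · α ^ k · i    ≡⟨ ^-+ α (k ℕ.* p) k i ⟨
    α ^ (k ℕ.* p ℕ.+ k) · i      ≡⟨ cong (α ^_· i) (trans (ℕ.+-comm (k ℕ.* p) k) (sym (ℕ.*-suc k p))) ⟩
    α ^ (k ℕ.* suc p) · i        ≡⟨ ^-multiple α (suc p) i e k ⟩
    i                            ∎)
    where open ≡-Reasoning

  cycleMin-unique : ∀ {i j} → IsCycleMin α i → IsCycleMin α j → SameCycle α i j → i ≡ j
  cycleMin-unique min-i min-j i~j = ≤-antisym (min-i _ i~j) (min-j _ (sameCycle-sym i~j))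

  -- p and q mark the least elements of the 2-cycles and of the longer cycles.
  -- Shifting their sums along α charges each such cycle to two, respectively
  -- three, of its points.
  6z≤2n+#involuted : (∀ i → α ⟨$⟩ʳ i ≢ i) → 6 ℕ.* z α ℕ.≤ 2 ℕ.* suc m ℕ.+ #involuted
  6z≤2n+#involuted αi≢i = subst (λ k → 6 ℕ.* k ℕ.≤ 2 ℕ.* suc m ℕ.+ #involuted) (sym z≡) bound
    where
    p? : Decidable (λ i → IsCycleMin α i × Involuted i)
    p? i = isCycleMin? α i ×-dec involuted? i
    q? : Decidable (λ i → IsCycleMin α i × ¬ Involuted i)
    q? i = isCycleMin? α i ×-dec ¬? (involuted? i)

    p q : Vector ℕ (suc m)
    p i = 𝟙 (p? i)
    q i = 𝟙 (q? i)

    z≡ : z α ≡ sum p ℕ.+ sum q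
    z≡ = length-filter-split (isCycleMin? α) involuted?

    distinct-min : ∀ {i j} → i ≢ j → SameCycle α i j → ¬ (IsCycleMin α i × IsCycleMin α j)
    distinct-min i≢j i~j (min-i , min-j) = i≢j (cycleMin-unique min-i min-j i~j)

    p-bound : ∀ i (t : Dec (Involuted i)) → p i ℕ.+ p (α ⟨$⟩ʳ i) ℕ.≤ 𝟙 t
    p-bound i (yes _) = 𝟙-exclusive (p? i) (p? (α ⟨$⟩ʳ i))
      λ ((min-i , _) , (min-j , _)) → distinct-min (αi≢i i ∘ sym) (1 , refl) (min-i , min-j)
    -- Off the 2-cycles both terms vanish: if α³(i) = α(i), then injectivity gives α²(i) = i.
    p-bound i (no ¬t) = ℕ.≤-reflexive (cong₂ ℕ._+_
      (𝟙-no (p? i) (¬t ∘ proj₂)) (𝟙-no (p? (α ⟨$⟩ʳ i)) (¬t ∘ α-injective α ∘ proj₂)))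

    q-bound : ∀ i (t : Dec (Involuted i)) → q i ℕ.+ q (α ⟨$⟩ʳ i) ℕ.+ q (α ⟨$⟩ʳ (α ⟨$⟩ʳ i)) ℕ.≤ 𝟙 (¬? t)
    -- The points i, α(i), α²(i) are pairwise distinct and lie on one cycle, so at most one of them
    -- is its least element. That the first differs from the third is `¬t`; the other two
    -- inequalities hold because there is no fixed point.
    q-bound i (no ¬t) = 𝟙-exclusive₃ (q? i) (q? (α ⟨$⟩ʳ i)) (q? (α ⟨$⟩ʳ (α ⟨$⟩ʳ i)))
      (λ ((min-i , _) , (min-j , _)) → distinct-min (αi≢i i ∘ sym) (1 , refl) (min-i , min-j))
      (λ ((min-i , _) , (min-j , _)) → distinct-min (¬t ∘ sym) (2 , refl) (min-i , min-j))
      (λ ((min-i , _) , (min-j , _)) → distinct-min (αi≢i (α ⟨$⟩ʳ i) ∘ sym) (1 , refl) (min-i , min-j))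
    q-bound i (yes t) = ℕ.≤-reflexive (cong₂ ℕ._+_ (cong₂ ℕ._+_
      (𝟙-no (q? i) (λ (_ , ¬t) → ¬t t))
      (𝟙-no (q? (α ⟨$⟩ʳ i)) (λ (_ , ¬t) → ¬t (cong (α ⟨$⟩ʳ_) t))))
      (𝟙-no (q? (α ⟨$⟩ʳ (α ⟨$⟩ʳ i))) (λ (_ , ¬t) → ¬t (cong (λ j → α ⟨$⟩ʳ (α ⟨$⟩ʳ j)) t))))

    bound : 6 ℕ.* (sum p ℕ.+ sum q) ℕ.≤ 2 ℕ.* suc m ℕ.+ #involuted
    bound = weighted-sum-bound α p q (λ i → 𝟙 (involuted? i)) (λ i → 𝟙 (¬? (involuted? i)))
      (λ i → p-bound i (involuted? i))
      (λ i → q-bound i (involuted? i))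
      (λ i → 𝟙-exclusive (involuted? i) (¬? (involuted? i)) λ (t , ¬t) → ¬t t)

-- From cycle counts and the genus formula to the bound on n.

-- Let β = α⁻¹ζ and j = β(i). If β(j) = i, then applying α to both relations yields α(j) = ζ(i) and
-- α(i) = ζ(j), so the edges at i and j are parallel. If also α²(i) = i, one of them lies on a
-- 2-cycle of `α`, which semiprimitivity forbids.
involuted-exclusive : (α : Perm m) → IsSemiprimitivePartition α →
                      ∀ i → ¬ (Involuted α i × Involuted (α⁻¹ζ α) i)
involuted-exclusive α (_ , (α-free , β-free) , semi) i (αα , ββ) =
  semi i j (β-free i ∘ sym , αi≡ζj , inverseʳ α) (α-free i , αα)
  where
  j = α⁻¹ζ α ⟨$⟩ʳ i
  αi≡ζj : α ⟨$⟩ʳ i ≡ ζ ⟨$⟩ʳ j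
  αi≡ζj = trans (cong (α ⟨$⟩ʳ_) (sym ββ)) (inverseʳ α)

6[z+z]≤5n : (α : Perm m) → IsSemiprimitivePartition α →
            6 ℕ.* (z α ℕ.+ z (α⁻¹ζ α)) ℕ.≤ 5 ℕ.* suc m
6[z+z]≤5n {m} α semi@(_ , (α-free , β-free) , _) =
  combine (suc m) (z α) (z (α⁻¹ζ α)) (#involuted α) (#involuted (α⁻¹ζ α))
    (6z≤2n+#involuted α α-free) (6z≤2n+#involuted (α⁻¹ζ α) β-free) disjoint
  where
  -- The two cycle bounds add up to 4n plus the number of points on 2-cycles of `α` or of α⁻¹ζ;
  -- disjointness bounds that number by n.
  disjoint : #involuted α ℕ.+ #involuted (α⁻¹ζ α) ℕ.≤ suc m
  disjoint = sum-disjoint (λ i → 𝟙 (involuted? α i)) (λ i → 𝟙 (involuted? (α⁻¹ζ α) i)) λ i →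
    𝟙-exclusive (involuted? α i) (involuted? (α⁻¹ζ α) i) (involuted-exclusive α semi i)
  regroup : ∀ n s t → (2 ℕ.* n ℕ.+ s) ℕ.+ (2 ℕ.* n ℕ.+ t) ≡ 4 ℕ.* n ℕ.+ (s ℕ.+ t)
  regroup = solve-∀
  combine : ∀ n x y s t → 6 ℕ.* x ℕ.≤ 2 ℕ.* n ℕ.+ s → 6 ℕ.* y ℕ.≤ 2 ℕ.* n ℕ.+ t →
            s ℕ.+ t ℕ.≤ n → 6 ℕ.* (x ℕ.+ y) ℕ.≤ 5 ℕ.* n
  combine n x y s t x-bound y-bound s+t≤n = begin
    6 ℕ.* (x ℕ.+ y)                      ≡⟨ ℕ.*-distribˡ-+ 6 x y ⟩
    6 ℕ.* x ℕ.+ 6 ℕ.* y                  ≤⟨ ℕ.+-mono-≤ x-bound y-bound ⟩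
    (2 ℕ.* n ℕ.+ s) ℕ.+ (2 ℕ.* n ℕ.+ t)  ≡⟨ regroup n s t ⟩
    4 ℕ.* n ℕ.+ (s ℕ.+ t)                ≤⟨ ℕ.+-monoʳ-≤ (4 ℕ.* n) s+t≤n ⟩
    4 ℕ.* n ℕ.+ n                        ≡⟨ ℕ.+-comm (4 ℕ.* n) n ⟩
    5 ℕ.* n                              ∎
    where open ℕ.≤-Reasoning

-- The genus formula is stated with an integer subtraction; moving 2g to the other side makes it an
-- equation between natural numbers.
n+1≡z+z+2g : (α : Perm m) (g : ℕ) → HasGenus α g →
              suc m ℕ.+ 1 ≡ (z α ℕ.+ z (α⁻¹ζ α)) ℕ.+ 2 ℕ.* g
n+1≡z+z+2g {m} α g e = ℤ.+-injective
  (trans (cancel (+ (suc m ℕ.+ 1)) (+ (2 ℕ.* g))) (cong (ℤ._+ + (2 ℕ.* g)) e))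
  where
  cancel : ∀ i j → i ≡ (i - j) ℤ.+ j
  cancel = ℤ-Solver.solve-∀

semiprimitive⇒n+6≤12g : (α : Perm m) (g : ℕ) → IsSemiprimitivePartition α → HasGenus α g →
                        suc m ℕ.+ 6 ℕ.≤ 12 ℕ.* g
semiprimitive⇒n+6≤12g {m} α g semi genus =
  combine (suc m) (z α ℕ.+ z (α⁻¹ζ α)) (n+1≡z+z+2g α g genus) (6[z+z]≤5n α semi)
  where
  regroup : ∀ n → 5 ℕ.* n ℕ.+ (n ℕ.+ 6) ≡ 6 ℕ.* (n ℕ.+ 1)
  regroup = solve-∀
  regroup′ : ∀ Z g → 6 ℕ.* (Z ℕ.+ 2 ℕ.* g) ≡ 6 ℕ.* Z ℕ.+ 12 ℕ.* g
  regroup′ = solve-∀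
  combine : ∀ n Z → n ℕ.+ 1 ≡ Z ℕ.+ 2 ℕ.* g → 6 ℕ.* Z ℕ.≤ 5 ℕ.* n → n ℕ.+ 6 ℕ.≤ 12 ℕ.* g
  -- Adding 5n to both sides turns the left one into 6(n + 1), to which the genus formula applies
  -- directly.
  combine n Z n+1≡Z+2g 6Z≤5n = ℕ.+-cancelˡ-≤ (5 ℕ.* n) (n ℕ.+ 6) (12 ℕ.* g) (begin
    5 ℕ.* n ℕ.+ (n ℕ.+ 6)     ≡⟨ regroup n ⟩
    6 ℕ.* (n ℕ.+ 1)           ≡⟨ cong (6 ℕ.*_) n+1≡Z+2g ⟩
    6 ℕ.* (Z ℕ.+ 2 ℕ.* g)     ≡⟨ regroup′ Z g ⟩
    6 ℕ.* Z ℕ.+ 12 ℕ.* g      ≤⟨ ℕ.+-monoˡ-≤ (12 ℕ.* g) 6Z≤5n ⟩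
    5 ℕ.* n ℕ.+ 12 ℕ.* g      ∎)
    where open ℕ.≤-Reasoning

-- The subtraction is carried out in the integers, where 12g - 6 = 6(2g - 1) also holds for g = 0,
-- with a negative value.
n+6≤12g⇒n≤6[2g-1] : ∀ n g → n ℕ.+ 6 ℕ.≤ 12 ℕ.* g → + n ≤ + 6 * (+ 2 * + g - + 1)
n+6≤12g⇒n≤6[2g-1] n g n+6≤12g = begin
  + n                          ≡⟨ cancel (+ n) (+ 6) ⟩
  + (n ℕ.+ 6) - + 6            ≤⟨ ℤ.+-monoˡ-≤ (ℤ.- + 6) (+≤+ n+6≤12g) ⟩
  + (12 ℕ.* g) - + 6           ≡⟨ cong (_- + 6) (ℤ.pos-* 12 g) ⟩
  + 12 * + g - + 6             ≡⟨ regroup (+ g) ⟩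
  + 6 * (+ 2 * + g - + 1)      ∎
  where
  open ℤ.≤-Reasoning
  cancel : ∀ i j → i ≡ (i ℤ.+ j) - j
  cancel = ℤ-Solver.solve-∀
  regroup : ∀ i → + 12 * i - + 6 ≡ + 6 * (+ 2 * i - + 1)
  regroup = ℤ-Solver.solve-∀

primitive⇒semiprimitive : (α : Perm m) → IsPrimitivePartition α → IsSemiprimitivePartition α
primitive⇒semiprimitive α (part , red , prim) = part , red , λ i j par _ → prim i j par

-- Decidability

isCycleLength? : (α : Perm m) → ∀ i ℓ → Dec (IsCycleLength α i ℓ)
isCycleLength? α i ℓ = 0 ℕ.<? ℓ ×-dec α ^ ℓ · i ≟ i ×-dec
  -- Minimality quantifies over all `k`. By contraposition it says that no positive `k` below `ℓ` is
  -- a return time, which is a finite check.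
  map′ (λ below k 0<k e → ℕ.≮⇒≥ λ k<ℓ → below k<ℓ 0<k e)
       (λ least {k} k<ℓ 0<k e → ℕ.<⇒≱ k<ℓ (least k 0<k e))
       (ℕ.allUpTo? (λ k → 0 ℕ.<? k →-dec ¬? (α ^ k · i ≟ i)) ℓ)

isPartition? : (α : Perm m) → Dec (IsPartition α)
isPartition? {m} α =
  map′ (λ below i ℓ min len → below i (cycleLength-bounded i ℓ len) min len)
       (λ part i {ℓ} _ → part i ℓ)
       -- A cycle on `suc m` points has length at most `suc m`, so testing the lengths below `2 + m`
       -- covers every `ℓ`.
       (all? λ i → ℕ.allUpTo? (λ ℓ → isCycleMin? α i →-dec (isCycleLength? α i ℓ →-dec
         linked? _<?_ (iterate (α ⟨$⟩ʳ_) i ℓ))) (2 ℕ.+ m))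
  where
  cycleLength-bounded : ∀ i ℓ → IsCycleLength α i ℓ → ℓ ℕ.< 2 ℕ.+ m
  cycleLength-bounded i ℓ (_ , _ , least) with p , p≤m , e ← period α i =
    s≤s (ℕ.≤-trans (least (suc p) z<s e) (s≤s p≤m))

isReduced? : (α : Perm m) → Dec (IsReduced α)
isReduced? α = all? (λ i → ¬? (α ⟨$⟩ʳ i ≟ i)) ×-dec all? (λ i → ¬? (α⁻¹ζ α ⟨$⟩ʳ i ≟ i))

parallel? : (α : Perm m) → ∀ i j → Dec (Parallel α i j)
parallel? α i j =
  ¬? (i ≟ j) ×-dec α ⟨$⟩ʳ i ≟ ζ ⟨$⟩ʳ j ×-dec α ⟨$⟩ʳ j ≟ ζ ⟨$⟩ʳ i

in2Cycle? : (α : Perm m) → ∀ i → Dec (In2Cycle α i)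
in2Cycle? α i = ¬? (α ⟨$⟩ʳ i ≟ i) ×-dec involuted? α i

hasGenus? : (α : Perm m) (g : ℕ) → Dec (HasGenus α g)
hasGenus? α g = _ ℤ.≟ _

isSemiprimitivePartition? : (α : Perm m) → Dec (IsSemiprimitivePartition α)
isSemiprimitivePartition? α = isPartition? α ×-dec isReduced? α ×-dec
  all? λ i → all? λ j → parallel? α i j →-dec ¬? (in2Cycle? α i)

isPrimitivePartition? : (α : Perm m) → Dec (IsPrimitivePartition α)
isPrimitivePartition? α = isPartition? α ×-dec isReduced? α ×-dec
  all? λ i → all? λ j → ¬? (parallel? α i j)

-- Invariance under pointwise equality

≈-sym : {α β : Perm m} → α ≈ β → β ≈ α
≈-sym e i = sym (e i)

iterate-cong : {f g : A → A} → f ≗ g → ∀ x n → iterate f x n ≡ iterate g x n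
iterate-cong         f≗g x zero    = refl
iterate-cong {g = g} f≗g x (suc n) = cong (x ∷_)
  (trans (cong (λ y → iterate _ y n) (f≗g x)) (iterate-cong f≗g (g x) n))

^-cong : {α β : Perm m} → α ≈ β → ∀ k i → α ^ k · i ≡ β ^ k · i
^-cong             e zero    i = refl
^-cong {α = α} {β} e (suc k) i = trans (cong (α ⟨$⟩ʳ_) (^-cong {α = α} {β} e k i)) (e _)

-- The relation `≈` compares only the forward functions. The inverses agree as well, because α sends
-- both candidate preimages to `i` and is injective.
⟨$⟩ˡ-cong : {α β : Perm m} → α ≈ β → ∀ i → α ⟨$⟩ˡ i ≡ β ⟨$⟩ˡ i
⟨$⟩ˡ-cong {α = α} {β} e i =
  α-injective α (trans (inverseʳ α) (sym (trans (e (β ⟨$⟩ˡ i)) (inverseʳ β))))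

α⁻¹ζ-cong : {α β : Perm m} → α ≈ β → α⁻¹ζ α ≈ α⁻¹ζ β
α⁻¹ζ-cong {α = α} {β} e i = ⟨$⟩ˡ-cong {α = α} {β} e (ζ ⟨$⟩ʳ i)

isCycleMin-resp : {α β : Perm m} → α ≈ β → ∀ {i} → IsCycleMin α i → IsCycleMin β i
isCycleMin-resp {α = α} {β} e min j (k , eₖ) =
  min j (k , trans (^-cong {α = α} {β} e k _) eₖ)

isCycleLength-resp : {α β : Perm m} → α ≈ β → ∀ {i ℓ} → IsCycleLength α i ℓ → IsCycleLength β i ℓ
isCycleLength-resp {α = α} {β} e {i} {ℓ} (0<ℓ , eₗ , least) =
  0<ℓ , trans (sym (^-cong {α = α} {β} e ℓ i)) eₗ ,
  λ k 0<k eₖ → least k 0<k (trans (^-cong {α = α} {β} e k i) eₖ)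

z-cong : {α β : Perm m} → α ≈ β → z α ≡ z β
z-cong {m} {α} {β} e = cong length (filter-≐ (isCycleMin? α) (isCycleMin? β)
  (isCycleMin-resp {α = α} {β} e , isCycleMin-resp {α = β} {α} (≈-sym {α = α} {β} e))
  (allFin (suc m)))

hasGenus-resp : {α β : Perm m} → α ≈ β → ∀ g → HasGenus α g → HasGenus β g
hasGenus-resp {α = α} {β} e g h = trans h (cong₂ (λ x y → + (x ℕ.+ y))
  (z-cong {α = α} {β} e)
  (z-cong {α = α⁻¹ζ α} {α⁻¹ζ β} (α⁻¹ζ-cong {α = α} {β} e)))

isPartition-resp : {α β : Perm m} → α ≈ β → IsPartition α → IsPartition β
isPartition-resp {α = α} {β} e part i ℓ min len = subst (Linked Fin._<_) (iterate-cong e i ℓ)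
  (part i ℓ (isCycleMin-resp {α = β} {α} e′ min) (isCycleLength-resp {α = β} {α} e′ len))
  where
  e′ : β ≈ α
  e′ = ≈-sym {α = α} {β} e

isReduced-resp : {α β : Perm m} → α ≈ β → IsReduced α → IsReduced β
isReduced-resp {α = α} {β} e (α-free , α⁻¹ζ-free) =
  (λ i → α-free i ∘ trans (e i)) ,
  (λ i → α⁻¹ζ-free i ∘ trans (α⁻¹ζ-cong {α = α} {β} e i))

parallel-resp : {α β : Perm m} → α ≈ β → ∀ {i j} → Parallel α i j → Parallel β i j
parallel-resp e (i≢j , eᵢ , eⱼ) = i≢j , trans (sym (e _)) eᵢ , trans (sym (e _)) eⱼ

in2Cycle-resp : {α β : Perm m} → α ≈ β → ∀ {i} → In2Cycle α i → In2Cycle β i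
in2Cycle-resp {α = α} {β} e {i} (αi≢i , αα) =
  αi≢i ∘ trans (e i) , trans (sym (^-cong {α = α} {β} e 2 i)) αα

isSemiprimitivePartition-resp : {α β : Perm m} → α ≈ β →
                                IsSemiprimitivePartition α → IsSemiprimitivePartition β
isSemiprimitivePartition-resp {α = α} {β} e (part , red , semi) =
  isPartition-resp {α = α} {β} e part , isReduced-resp {α = α} {β} e red ,
  λ i j par two → semi i j (parallel-resp {α = β} {α} e′ par) (in2Cycle-resp {α = β} {α} e′ two)
  where
  e′ : β ≈ α
  e′ = ≈-sym {α = α} {β} e

isPrimitivePartition-resp : {α β : Perm m} → α ≈ β →
                            IsPrimitivePartition α → IsPrimitivePartition β
isPrimitivePartition-resp {α = α} {β} e (part , red , prim) =
  isPartition-resp {α = α} {β} e part , isReduced-resp {α = α} {β} e red ,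
  λ i j par → prim i j (parallel-resp {α = β} {α} (≈-sym {α = α} {β} e) par)

-- Finiteness

module _ {c ℓ} (S : Setoid c ℓ) where
  open Setoid S using () renaming (_≈_ to _≈ₛ_; sym to ≈ₛ-sym)

  lookup-injective : ∀ {xs} → Unique S xs → ∀ {i j} → lookup xs i ≈ₛ lookup xs j → i ≡ j
  lookup-injective (_  ∷ _)  {zero}  {zero}  _ = refl
  lookup-injective (x≉ ∷ _)  {zero}  {suc j} e = contradiction e (All.lookup x≉ (∈-lookup j))
  lookup-injective (x≉ ∷ _)  {suc i} {zero}  e = contradiction (≈ₛ-sym e) (All.lookup x≉ (∈-lookup i))
  lookup-injective (_  ∷ xs) {suc i} {suc j} e = cong suc (lookup-injective xs e)

-- Removing repetitions from a complete list keeps it complete and makes its entries pairwise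
-- inequivalent, so looking up a position is a bijection.
enumeration⇒inverse : ∀ {c ℓ} (S : DecSetoid c ℓ) {xs} → IsEnumeration (DecSetoid.setoid S) xs →
                      ∃[ k ] Inverse (setoid (Fin k)) (DecSetoid.setoid S)
enumeration⇒inverse S {xs} enum = length ys , Bijection⇒Inverse record
  { to        = lookup ys
  ; cong      = λ { refl → DecSetoid.refl S }
  ; bijective = lookup-injective (DecSetoid.setoid S) (deduplicate-! S xs) ,
                lookup-surjective (DecSetoid.setoid S) (deduplicate⁺ S enum)
  }
  where
  ys = deduplicate (DecSetoid._≟_ S) xs

-- Recursion on the image of `zero`: each choice is combined with each permutation of the remaining
-- points.
permutations : ∀ n → List (Permutation′ n)
permutations zero    = id ∷ []
permutations (suc n) = cartesianProductWith (insert zero) (allFin (suc n)) (permutations n)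

insert-cong : ∀ i j {π ρ : Permutation′ n} → π ≈ ρ → insert i j π ≈ insert i j ρ
insert-cong i j e k with i ≟ k
... | yes _ = refl
... | no  _ = cong (Fin.punchIn j) (e _)

-- Every `π` is recovered by taking `zero` out and inserting it again with its image π(0). The
-- recursive call finds the remainder only up to `≈`, hence the appeal to `insert-cong`.
permutations-complete : (π : Permutation′ n) → Any (π ≈_) (permutations n)
permutations-complete {zero}  π = here λ ()
permutations-complete {suc n} π = Any.cartesianProductWith⁺ (insert zero)
  (λ { {y = ρ} refl e k → trans (sym (insert-remove zero π k))
                                (insert-cong zero _ {remove zero π} {ρ} e k) })
  (∈-allFin (π ⟨$⟩ʳ zero)) (permutations-complete (remove zero π))

module _ (P : ∀ {m} → Perm m → Set)
         (P? : ∀ {m} (α : Perm m) → Dec (P α))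
         (P-resp : ∀ {m} {α β : Perm m} → α ≈ β → P α → P β)
         where

  permWith-decSetoid : DecSetoid 0ℓ 0ℓ
  permWith-decSetoid = record
    { isDecEquivalence = record
      { isEquivalence = Setoid.isEquivalence (PermWithSetoid P)
      ; _≟_           = decide
      }
    }
    where
    decide : ∀ x y → Dec (_≋_ P x y)
    decide (permWith {m} α _) (permWith {n} β _) with m ℕ.≟ n
    ... | no  m≢n  = no λ { (same _) → m≢n refl }
    ... | yes refl = map′ same (λ { (same e) → e }) (all? λ i → α ⟨$⟩ʳ i ≟ β ⟨$⟩ʳ i)

  private
    fromDec : {α : Perm m} → Dec (P α) → List (PermWith P)
    fromDec (yes p) = permWith _ p ∷ []
    fromDec (no _)  = []

    candidates : ℕ → List (PermWith P)
    candidates m = concatMap (λ α → fromDec (P? α)) (permutations (suc m))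

    -- The list of permutations contains only some `β` that agrees pointwise with `α`. Invariance of
    -- `P` carries the property over to `β`, so the filter keeps it.
    fromDec-complete : {α β : Perm m} (p : P α) → α ≈ β → (d : Dec (P β)) →
                       Any (_≋_ P (permWith α p)) (fromDec d)
    fromDec-complete {α = α} {β} p e (yes _)  = here (same e)
    fromDec-complete {α = α} {β} p e (no ¬p) = contradiction (P-resp {α = α} {β} e p) ¬p

    candidates-complete : (α : Perm m) (p : P α) → Any (_≋_ P (permWith α p)) (candidates m)
    candidates-complete α p = Any.concatMap⁺ (λ β → fromDec (P? β))
      (Any.map (λ {β} e → fromDec-complete p e (P? β)) (permutations-complete α))

  bounded⇒finitelyMany : ∀ N → (∀ {m} (α : Perm m) → P α → m ℕ.< N) → FinitelyMany P
  bounded⇒finitelyMany N bound = enumeration⇒inverse permWith-decSetoid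
    {concatMap candidates (upTo N)}
    λ (permWith α p) → Any.concatMap⁺ candidates
      (lose (∈-upTo⁺ (bound α p)) (candidates-complete α p))

-- The claims for a fixed genus.

finitelyManySemiprimitive : ∀ g → FinitelyMany (λ α → IsSemiprimitivePartition α × HasGenus α g)
finitelyManySemiprimitive g = bounded⇒finitelyMany _
  (λ α → isSemiprimitivePartition? α ×-dec hasGenus? α g)
  (λ {_} {α} {β} e (semi , genus) →
    isSemiprimitivePartition-resp {α = α} {β} e semi , hasGenus-resp {α = α} {β} e g genus)
  -- From n + 6 ≤ 12g with n = `suc m`, dropping the 6 leaves `suc m ≤ 12 * g`, which is the
  -- required strict bound on `m`.
  (12 ℕ.* g)
  (λ α (semi , genus) → ℕ.m+n≤o⇒m≤o _ (semiprimitive⇒n+6≤12g α g semi genus))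

finitelyManyPrimitive : ∀ g → FinitelyMany (λ α → IsPrimitivePartition α × HasGenus α g)
finitelyManyPrimitive g = bounded⇒finitelyMany _
  (λ α → isPrimitivePartition? α ×-dec hasGenus? α g)
  (λ {_} {α} {β} e (prim , genus) →
    isPrimitivePartition-resp {α = α} {β} e prim , hasGenus-resp {α = α} {β} e g genus)
  (12 ℕ.* g)
  (λ α (prim , genus) →
    ℕ.m+n≤o⇒m≤o _ (semiprimitive⇒n+6≤12g α g (primitive⇒semiprimitive α prim) genus))

theorem5p9 : (∀ (g : ℕ) {m : ℕ} (α : Perm m) → IsPrimitivePartition α → HasGenus α g →
    + suc m ≤ + 6 * (+ 2 * + g - + 1))
    × (∀ (g : ℕ) → FinitelyMany (λ α → IsSemiprimitivePartition α × HasGenus α g))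
    × (∀ (g : ℕ) → FinitelyMany (λ α → IsPrimitivePartition α × HasGenus α g))
theorem5p9 =
  (λ g {m} α prim genus → n+6≤12g⇒n≤6[2g-1] (suc m) g
    (semiprimitive⇒n+6≤12g α g (primitive⇒semiprimitive α prim) genus)) ,
  finitelyManySemiprimitive ,
  finitelyManyPrimitive
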